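{- For all impartial Conway's games $x,y\in\mathcal I$, $$g(x)=g(y)\iff x\approx y .$$
   Context: Hypergames: work in a universe of possibly non-wellfounded sets (set theory with the Antifoundation Axiom, and the Axiom of Choice). The class $\mathcal H$ of hypergames (also called games) is the carrier of the final coalgebra $(\mathcal H,\mathrm{id})$ of the functor $F(A)=\mathcal P(A)\times\mathcal P(A)$ on the category of classes and functional classes, where $\mathcal P$ is the powerset functor. Thus a hypergame is a pair $x=(X^L,X^R)$ of sets of hypergames; elements of $X^L$, $X^R$ are the Left and Right options of $x$. Positions of $x$ are the hypergames hereditarily reachable from $x$. Impartial Conway's games: a hypergame is impartial if at every position L and R have the same options; an impartial game is represented simply as the set $x=X$ of its options, identified with the hypergame $(X,X)$ (hereditarily). $\mathcal I$ is the class of well-founded impartial games, i.e. the carrier of the initial algebra of $\mathcal P$ (well-founded sets). Grundy function: for a set $S$ of ordinals, $\mathrm{mex}(S)$ is the least ordinal not in $S$. $g:\mathcal I\to\mathrm{Ord}$ is the Grundy-Sprague function, the unique function with $g(x)=\mathrm{mex}\{g(y)\mid y\in x\}$. Sum (on hypergames, defined coinductively): $x+y=(\{x^L+y\mid x^L\in X^L\}\cup\{x+y^L\mid y^L\in Y^L\},\ \{x^R+y\mid x^R\in X^R\}\cup\{x+y^R\mid y^R\in Y^R\})$. Plays: L (Left) and R (Right) move alternately; either may start. Player I is the one who starts, player II the other one; LI means L acting as player I, and similarly LII, RI, RII. A play on $x$ is a (possibly empty) finite or infinite sequence $x_1^{K_1}x_2^{K_2}\cdots$ with $K_i\in\{L,R\}$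 and $K_{i+1}\neq K_i$, such that, with $x_0=x$ and $x_i=(X_i^L,X_i^R)$, one has $x_{i+1}\in X_i^{K_{i+1}}$ for all $i\ge 0$. A finite play is winning for L (resp. R) if it ends with a position $y=(Y^L,Y^R)$ where R (resp. L) is next to move but $Y^R=\emptyset$ (resp. $Y^L=\emptyset$); the empty play ends at $x$ with the starting player next to move. Every infinite play is a draw. A play is non-losing for L (resp. R) if it is winning for L (resp. R) or is a draw. Strategies: for P in $\{$LI, LII, RI, RII$\}$ let $\mathrm{FPlay}^P_x$ be the set of finite plays on $x$ in which P has the prescribed role (first or second player) and is next to move (the empty play is included exactly when P is LI or RI). A strategy for P on $x$ is a partial function $f$ from $\mathrm{FPlay}^P_x$ to positions of $x$ such that $f(\pi)=x'$ implies that $\pi x'$ is a play, and $f(\pi)$ is defined whenever some $\pi x'$ is a play. The opponent of LI is RII, and of LII is RI (and conversely). A play $\pi$ is coherent with $f$ if for each proper prefix $\pi'$ of $\pi$ where P is next to move, $f(\pi')=x'$ implies $\pi'x'$ is a prefix of $\pi$. For a strategy $f$ for P and a strategy $f'$ for the opponent, $f*f'$ is the unique maximal play coherent with both. $f$ is non-losing for P if $f*f'$ is non-losing for P (i.e. for L or R accordingly) for every strategy $f'$ of the opponent. A strategy for L is a pair of strategies for LI and LII; for R, for RI and RII; for I, for LI and RI; for II, for LII and RII. Such a pair is non-losing if both components are. Equideterminacy: $x\Updownarrow y$ iff, for each player P in $\{$L, R, I, II$\}$, $x$ has a non-losing strategy for P if and only if $y$ does. Contextual equivalence: additive contexts are $C[\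 ]::=[\ ]\mid C[\ ]+z\mid z+C[\ ]$ with $z$ any hypergame; $x\approx y$ iff $C[x]\Updownarrow C[y]$ for every additive context $C[\ ]$. -}

module Defs where

open import Axiom.ExcludedMiddle using (ExcludedMiddle)
open import Data.Empty using (⊥)
open import Data.List.Base using (List; []; _∷_; _∷ʳ_; length; applyUpTo)
open import Data.List.Relation.Binary.Pointwise as Listwise using ()
open import Data.List.Relation.Binary.Prefix.Heterogeneous using (Prefix)
open import Data.Maybe using (Maybe; just; Is-just)
open import Data.Maybe.Relation.Binary.Pointwise as Maybewise using ()
open import Data.Nat.Base using (ℕ; zero; suc; _<_)
open import Data.Product.Base using (Σ; ∃-syntax; Σ-syntax; _×_; _,_; proj₁; proj₂)
open import Data.Sum.Base using (_⊎_; inj₁; inj₂)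
open import Function.Bundles using (_⇔_)
open import Level using (Level) renaming (zero to 0ℓ; suc to lsuc)
open import Relation.Binary.PropositionalEquality.Core using (_≡_; refl; subst; sym)
open import Relation.Nullary.Decidable using (yes; no; True; toWitness; fromWitness)
open import Relation.Nullary.Negation using (¬_; contradiction)

-- The mathematics takes place in classical set theory with choice.  Wherever
-- that matters it appears as an explicit ExcludedMiddle argument; this decides
-- arbitrary types, not just propositions, and so provides choice as well.

------------------------------------------------------------------------
-- Hypergames

data Side : Set where
  L R : Side

opponent : Side → Side
opponent L = R
opponent R = L

-- A coalgebra of F(A) = P(A) × P(A).  A "set" of elements of the carrier is a
-- family indexed by a type in Set, and a "class" is a type in Set₁.

record Coalgebra (ℓ : Level) : Set (lsuc ℓ) where
  field
    Carrier : Set ℓ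
    Move    : Side → Carrier → Set
    next    : ∀ K c → Move K c → Carrier

open Coalgebra

-- The final coalgebra of F is realised by pointed small coalgebras, equality
-- being bisimilarity; this is the antifoundation axiom read as a definition.
-- Finality for class-sized coalgebras is checked below (unfold-isHom and
-- unfold-unique).

record Hypergame : Set₁ where
  constructor pointed
  field
    graph : Coalgebra 0ℓ
    root  : Carrier graph

open Hypergame

Option : Side → Hypergame → Set
Option K x = Move (graph x) K (root x)

option : ∀ K x → Option K x → Hypergame
option K x i = pointed (graph x) (next (graph x) K (root x) i)

record IsBisimulation (A B : Coalgebra 0ℓ) (_∼_ : Carrier A → Carrier B → Set) : Set where
  field
    forth : ∀ {a b} → a ∼ b → ∀ K (i : Move A K a) →
            ∃[ j ] (next A K a i ∼ next B K b j)
    back  : ∀ {a b} → a ∼ b → ∀ K (j : Move B K b) →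
            ∃[ i ] (next A K a i ∼ next B K b j)

open IsBisimulation

infix 4 _≅_ _∈[_]_

_≅_ : Hypergame → Hypergame → Set₁
x ≅ y = Σ (Carrier (graph x) → Carrier (graph y) → Set) λ _∼_ →
        IsBisimulation (graph x) (graph y) _∼_ × (root x ∼ root y)

-- x′ ∈[ K ] x says that x′ belongs to X^K, where x = (X^L , X^R).

_∈[_]_ : Hypergame → Side → Hypergame → Set₁
x′ ∈[ K ] x = ∃[ i ] (option K x i ≅ x′)

≅-refl : ∀ {x} → x ≅ x
≅-refl = _≡_
  , record { forth = λ { refl _ i → i , refl } ; back = λ { refl _ j → j , refl } }
  , refl

≅-sym : ∀ {x y} → x ≅ y → y ≅ x
≅-sym (_∼_ , bis , r) = (λ b a → a ∼ b) , record { forth = back bis ; back = forth bis } , r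

≅-trans : ∀ {x y z} → x ≅ y → y ≅ z → x ≅ z
≅-trans {x} {y} {z} (_∼_ , bis , r) (_∼′_ , bis′ , r′) =
  (λ a c → ∃[ b ] (a ∼ b × b ∼′ c)) , record { forth = forth″ ; back = back″ } , _ , r , r′
  where
  forth″ : ∀ {a c} → ∃[ b ] (a ∼ b × b ∼′ c) → ∀ K (i : Move (graph x) K a) →
           ∃[ k ] ∃[ b ] (next (graph x) K a i ∼ b × b ∼′ next (graph z) K c k)
  forth″ (b , p , q) K i with forth bis p K i
  ... | j , p′ with forth bis′ q K j
  ... | k , q′ = k , _ , p′ , q′
  back″ : ∀ {a c} → ∃[ b ] (a ∼ b × b ∼′ c) → ∀ K (k : Move (graph z) K c) →
          ∃[ i ] ∃[ b ] (next (graph x) K a i ∼ b × b ∼′ next (graph z) K c k)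
  back″ (b , p , q) K k with back bis′ q K k
  ... | j , q′ with back bis p K j
  ... | i , p′ = i , _ , p′ , q′

------------------------------------------------------------------------
-- Coinductive definitions

-- The set of paths out of c, so that a class-sized coalgebra is only ever
-- unfolded along its (small) part reachable from c.

data Path (C : Coalgebra (lsuc 0ℓ)) (c : Carrier C) : Set where
  []  : Path C c
  _∷_ : ∀ {K} (i : Move C K c) → Path C (next C K c i) → Path C c

module _ (C : Coalgebra (lsuc 0ℓ)) where

  target : ∀ {c} → Path C c → Carrier C
  target {c} []      = c
  target     (i ∷ p) = target p

  extend : ∀ {c} (p : Path C c) {K} → Move C K (target p) → Path C c
  extend []      j = j ∷ []
  extend (i ∷ p) j = i ∷ extend p j

  unfold : Carrier C → Hypergame
  unfold c = pointed
    record { Carrier = Path C c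
           ; Move    = λ K p → Move C K (target p)
           ; next    = λ K p j → extend p j }
    []

  IsHom : (Carrier C → Hypergame) → Set₁
  IsHom h = ∀ c K →
    (∀ (i : Move C K c)     → ∃[ j ] (option K (h c) j ≅ h (next C K c i))) ×
    (∀ (j : Option K (h c)) → ∃[ i ] (option K (h c) j ≅ h (next C K c i)))

  unfold-isHom : IsHom unfold
  unfold-isHom c K = (λ i → i , step i) , (λ i → i , step i)
    where
    step : ∀ i → option K (unfold c) i ≅ unfold (next C K c i)
    step i = (λ p q → p ≡ i ∷ q)
      , record { forth = λ { refl _ j → j , refl } ; back = λ { refl _ j → j , refl } }
      , refl

  target-extend : ∀ {c} (p : Path C c) {K} (j : Move C K (target p)) →
                  target (extend p j) ≡ next C K (target p) j
  target-extend []      j = refl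
  target-extend (i ∷ p) j = target-extend p j

  unfold-unique : ExcludedMiddle (lsuc 0ℓ) → ∀ h → IsHom h → ∀ c → h c ≅ unfold c
  unfold-unique em h hom c =
    (λ a p → True (em {P = Rel a p})) ,
    record { forth = λ {_} {p} r K i → let j , r′ = forth′ p (toWitness r) K i in j , fromWitness r′
           ; back  = λ {_} {p} r K j → let i , r′ = back′ p (toWitness r) K j in i , fromWitness r′ } ,
    fromWitness ≅-refl
    where
    G : Coalgebra 0ℓ
    G = graph (h c)

    Rel : Carrier G → Path C c → Set₁
    Rel a p = pointed G a ≅ h (target p)

    conclude : ∀ {a} p K (j : Move C K (target p)) →
               pointed G a ≅ h (next C K (target p) j) → Rel a (extend p j)
    conclude p K j = subst (λ d → _ ≅ h d) (sym (target-extend p j))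

    forth′ : ∀ {a} p → Rel a p → ∀ K (i : Move G K a) →
             ∃[ j ] Rel (next G K a i) (extend p {K} j)
    forth′ p (_∼_ , bis , r) K i with forth bis r K i
    ... | k , r′ with proj₂ (hom (target p) K) k
    ... | j , e = j , conclude p K j (≅-trans (_∼_ , bis , r′) e)

    back′ : ∀ {a} p → Rel a p → ∀ K (j : Move C K (target p)) →
            ∃[ i ] Rel (next G K a i) (extend p {K} j)
    back′ p (_∼_ , bis , r) K j with proj₁ (hom (target p) K) j
    ... | k , e with back bis r K k
    ... | i , r′ = i , conclude p K j (≅-trans (_∼_ , bis , r′) e)

infixl 6 _+_

sumGraph : Coalgebra 0ℓ → Coalgebra 0ℓ → Coalgebra 0ℓ
sumGraph A B = record
  { Carrier = Carrier A × Carrier B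
  ; Move    = λ { K (a , b) → Move A K a ⊎ Move B K b }
  ; next    = λ { K (a , b) (inj₁ i) → next A K a i , b
                ; K (a , b) (inj₂ j) → a , next B K b j } }

_+_ : Hypergame → Hypergame → Hypergame
x + y = pointed (sumGraph (graph x) (graph y)) (root x , root y)

-- The coinductive equations for the sum hold on the nose.

+-optionˡ : ∀ K x y i → option K (x + y) (inj₁ i) ≡ option K x i + y
+-optionˡ K x y i = refl

+-optionʳ : ∀ K x y j → option K (x + y) (inj₂ j) ≡ x + option K y j
+-optionʳ K x y j = refl

------------------------------------------------------------------------
-- Well-founded sets: impartial Conway's games and von Neumann ordinals

data WfSet : Set₁ where
  sup : (A : Set) → (A → WfSet) → WfSet

infix 4 _≐_ _∈_

_≐_ : WfSet → WfSet → Set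
sup A f ≐ sup B g = (∀ a → ∃[ b ] (f a ≐ g b)) × (∀ b → ∃[ a ] (f a ≐ g b))

_∈_ : WfSet → WfSet → Set
u ∈ sup A f = ∃[ a ] (f a ≐ u)

Impartial : Set₁
Impartial = WfSet

-- The identification of an impartial game X with the hypergame (X , X),
-- hereditarily.

impartials : Coalgebra (lsuc 0ℓ)
impartials = record
  { Carrier = Impartial
  ; Move    = λ { _ (sup A f) → A }
  ; next    = λ { _ (sup A f) a → f a } }

⌜_⌝ : Impartial → Hypergame
⌜_⌝ = unfold impartials

Transitive : WfSet → Set₁
Transitive u = ∀ {v w} → w ∈ v → v ∈ u → w ∈ u

record Ord : Set₁ where
  constructor ord
  field
    set                : WfSet
    transitive         : Transitive set
    transitiveElements : ∀ {v} → v ∈ set → Transitive v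

open Ord

infix 4 _≈ₒ_ _<ₒ_ _≤ₒ_

_≈ₒ_ _<ₒ_ _≤ₒ_ : Ord → Ord → Set
α ≈ₒ β = set α ≐ set β
α <ₒ β = set α ∈ set β
α ≤ₒ β = (α <ₒ β) ⊎ (α ≈ₒ β)

-- α ∈ₒ S, for a set S of ordinals given as a family.

_∈ₒ_ : Ord → ∀ {A : Set} → (A → Ord) → Set
α ∈ₒ S = ∃[ a ] (S a ≈ₒ α)

record IsMex {A : Set} (S : A → Ord) (μ : Ord) : Set₁ where
  field
    excluded : ¬ (μ ∈ₒ S)
    least    : ∀ β → ¬ (β ∈ₒ S) → μ ≤ₒ β

≐-refl : ∀ u → u ≐ u
≐-refl (sup A f) = (λ a → a , ≐-refl (f a)) , (λ a → a , ≐-refl (f a))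

≐-sym : ∀ u v → u ≐ v → v ≐ u
≐-sym (sup A f) (sup B g) (p , q) =
  (λ b → let a , e = q b in a , ≐-sym (f a) (g b) e) ,
  (λ a → let b , e = p a in b , ≐-sym (f a) (g b) e)

≐-trans : ∀ u v w → u ≐ v → v ≐ w → u ≐ w
≐-trans (sup A f) (sup B g) (sup C h) (p , q) (p′ , q′) =
  (λ a → let b , e = p a ; c , e′ = p′ b in c , ≐-trans (f a) (g b) (h c) e e′) ,
  (λ c → let b , e = q′ c ; a , e′ = q b in a , ≐-trans (f a) (g b) (h c) e′ e)

∈-respˡ : ∀ {u v} w → u ≐ v → u ∈ w → v ∈ w
∈-respˡ {u} {v} (sup C h) e (c , e′) = c , ≐-trans (h c) u v e′ e

∈-respʳ : ∀ w u v → u ≐ v → w ∈ u → w ∈ v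
∈-respʳ w (sup A f) (sup B g) (p , _) (a , e) =
  let b , e′ = p a in b , ≐-trans (g b) (f a) w (≐-sym (f a) (g b) e′) e

∈-irrefl : ∀ u → ¬ (u ∈ u)
∈-irrefl (sup A f) (a , e) = ∈-irrefl (f a) (∈-respʳ (f a) (sup A f) (f a)
  (≐-sym (f a) (sup A f) e) (a , ≐-refl (f a)))

elem : ∀ {A} (f : A → WfSet) a → f a ∈ sup A f
elem f a = a , ≐-refl (f a)

trichotomy : ExcludedMiddle 0ℓ → ∀ α β → (α <ₒ β) ⊎ (α ≈ₒ β) ⊎ (β <ₒ α)
trichotomy em (ord u tu eu) (ord v tv ev) = compare u v tu eu tv ev
  where
  Comparable : WfSet → WfSet → Set
  Comparable u v = (u ∈ v) ⊎ (u ≐ v) ⊎ (v ∈ u)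

  combine : ∀ {A B} {f : A → WfSet} {g : B → WfSet} →
            Transitive (sup A f) → Transitive (sup B g) →
            (∀ a → Comparable (f a) (sup B g)) → (∀ b → Comparable (sup A f) (g b)) →
            Comparable (sup A f) (sup B g)
  combine {A} {B} {f} {g} tu tv lefts rights
    with em {P = sup A f ∈ sup B g} | em {P = sup B g ∈ sup A f}
  ... | yes u∈v | _       = inj₁ u∈v
  ... | no _    | yes v∈u = inj₂ (inj₂ v∈u)
  ... | no u∉v  | no v∉u  = inj₂ (inj₁ (left , right))
    where
    left : ∀ a → ∃[ b ] (f a ≐ g b)
    left a with lefts a
    ... | inj₁ (b , e)    = b , ≐-sym (g b) (f a) e
    ... | inj₂ (inj₁ e)   = contradiction (a , e) v∉u
    ... | inj₂ (inj₂ v∈a) = contradiction (tu v∈a (elem f a)) v∉u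
    right : ∀ b → ∃[ a ] (f a ≐ g b)
    right b with rights b
    ... | inj₁ u∈b            = contradiction (tv u∈b (elem g b)) u∉v
    ... | inj₂ (inj₁ e)       = contradiction (b , ≐-sym (sup A f) (g b) e) u∉v
    ... | inj₂ (inj₂ (a , e)) = a , e

  compare : ∀ u v → Transitive u → (∀ {w} → w ∈ u → Transitive w) →
            Transitive v → (∀ {w} → w ∈ v → Transitive w) → Comparable u v
  compare (sup A f) (sup B g) tu eu tv ev = combine tu tv
    (λ a → compare (f a) (sup B g) (eu (elem f a)) (λ w∈ → eu (tu w∈ (elem f a))) tv ev)
    (λ b → compare (sup A f) (g b) tu eu (ev (elem g b)) (λ w∈ → ev (tv w∈ (elem g b))))

-- The least ordinal not in S is the von Neumann ordinal { γ ∈ S ∣ γ ⊆ S }.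

mex-exists : ExcludedMiddle 0ℓ → ∀ {A : Set} (S : A → Ord) → ∃[ μ ] IsMex S μ
mex-exists em {A} S = μ , record { excluded = excluded ; least = least }
  where
  below : WfSet → Set
  below (sup B g) = ∀ b → ∃[ a ] (set (S a) ≐ g b)

  below-apply : ∀ u {v} → below u → v ∈ u → ∃[ a ] (set (S a) ≐ v)
  below-apply (sup B g) {v} u⊆S (b , e) =
    let a , e′ = u⊆S b in a , ≐-trans (set (S a)) (g b) v e′ e

  below-intro : ∀ u → (∀ {v} → v ∈ u → ∃[ a ] (set (S a) ≐ v)) → below u
  below-intro (sup B g) h b = h (elem g b)

  I : Set
  I = Σ[ a ∈ A ] below (set (S a))

  M : WfSet
  M = sup I (λ i → set (S (proj₁ i)))

  M-transitive : Transitive M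
  M-transitive {v} {w} w∈v ((a , a⊆S) , e) =
    let w∈a     = ∈-respʳ w v (set (S a)) (≐-sym (set (S a)) v e) w∈v
        a′ , e′ = below-apply (set (S a)) a⊆S w∈a
    in (a′ , below-intro (set (S a′)) λ {t} t∈a′ →
         below-apply (set (S a)) a⊆S
           (transitive (S a) (∈-respʳ t (set (S a′)) w e′ t∈a′) w∈a)) , e′

  M-elements : ∀ {v} → v ∈ M → Transitive v
  M-elements {v} ((a , _) , e) {v₁} {w} w∈v₁ v₁∈v =
    ∈-respʳ w (set (S a)) v e
      (transitive (S a) w∈v₁ (∈-respʳ v₁ v (set (S a)) (≐-sym (set (S a)) v e) v₁∈v))

  μ : Ord
  μ = ord M M-transitive M-elements

  M⊆S : ∀ {v} → v ∈ M → ∃[ a ] (set (S a) ≐ v)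
  M⊆S ((a , _) , e) = a , e

  excluded : ¬ (μ ∈ₒ S)
  excluded (a , e) = ∈-irrefl M ((a , below-intro (set (S a)) λ {v} v∈a →
    M⊆S (∈-respʳ v (set (S a)) M e v∈a)) , e)

  least : ∀ β → ¬ (β ∈ₒ S) → μ ≤ₒ β
  least β β∉S with trichotomy em μ β
  ... | inj₁ μ<β        = inj₁ μ<β
  ... | inj₂ (inj₁ μ≈β) = inj₂ μ≈β
  ... | inj₂ (inj₂ β<μ) = contradiction (M⊆S β<μ) β∉S

mex : ExcludedMiddle 0ℓ → {A : Set} → (A → Ord) → Ord
mex em S = proj₁ (mex-exists em S)

grundy : ExcludedMiddle 0ℓ → Impartial → Ord
grundy em (sup A f) = mex em (λ a → grundy em (f a))

------------------------------------------------------------------------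
-- Plays

-- A sequence of positions; the labels K₁ K₂ ⋯ are determined by the starting
-- side, as they alternate.

data Seq : Set₁ where
  fin : List Hypergame → Seq
  inf : (ℕ → Hypergame) → Seq

turn : Side → ℕ → Side
turn s zero    = s
turn s (suc n) = opponent (turn s n)

end : Hypergame → List Hypergame → Hypergame
end x []      = x
end x (y ∷ π) = end y π

data IsFinPlay : Side → Hypergame → List Hypergame → Set₁ where
  []  : ∀ {s x} → IsFinPlay s x []
  _∷_ : ∀ {s x y π} → y ∈[ s ] x → IsFinPlay (opponent s) y π → IsFinPlay s x (y ∷ π)

IsPlay : Side → Hypergame → Seq → Set₁
IsPlay s x (fin π) = IsFinPlay s x π
IsPlay s x (inf σ) = σ 0 ∈[ s ] x × (∀ n → σ (suc n) ∈[ turn s (suc n) ] σ n)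

-- Prefixes, with positions compared up to ≅.

infix 4 _⊑_ _⊏_

_⊑_ : List Hypergame → Seq → Set₁
π ⊑ fin ρ = Prefix _≅_ π ρ
π ⊑ inf σ = Listwise.Pointwise _≅_ π (applyUpTo σ (length π))

_⊏_ : List Hypergame → Seq → Set₁
π ⊏ fin ρ = π ⊑ fin ρ × length π < length ρ
π ⊏ inf σ = π ⊑ inf σ

Wins : Side → Side → Hypergame → List Hypergame → Set
Wins K s x π = turn s (length π) ≡ opponent K × ¬ Option (opponent K) (end x π)

data NonLosingPlay (K s : Side) (x : Hypergame) : Seq → Set₁ where
  win  : ∀ {π} → Wins K s x π → NonLosingPlay K s x (fin π)
  draw : ∀ {σ} → NonLosingPlay K s x (inf σ)

------------------------------------------------------------------------
-- Strategies

record Role : Set where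
  constructor role
  field
    side    : Side
    starter : Side

open Role

pattern LI  = role L L
pattern LII = role L R
pattern RI  = role R R
pattern RII = role R L

opposing : Role → Role
opposing P = role (opponent (side P)) (starter P)

record FPlay (P : Role) (x : Hypergame) : Set₁ where
  field
    moves  : List Hypergame
    isPlay : IsFinPlay (starter P) x moves
    toMove : turn (starter P) (length moves) ≡ side P

open FPlay

-- Partial functions are Maybe-valued.  Since positions are sets, a strategy has
-- to respect their equality ≅.

record Strategy (P : Role) (x : Hypergame) : Set₁ where
  field
    reply : FPlay P x → Maybe Hypergame
    legal : ∀ π {x′} → reply π ≡ just x′ → IsFinPlay (starter P) x (moves π ∷ʳ x′)
    total : ∀ π {x′} → IsFinPlay (starter P) x (moves π ∷ʳ x′) → Is-just (reply π)
    resp  : ∀ π π′ → Listwise.Pointwise _≅_ (moves π) (moves π′) →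
            Maybewise.Pointwise _≅_ (reply π) (reply π′)

open Strategy

Coherent : ∀ {P x} → Strategy P x → Seq → Set₁
Coherent {P} {x} f ρ = ∀ (π : FPlay P x) → moves π ⊏ ρ →
                       ∀ {x′} → reply f π ≡ just x′ → (moves π ∷ʳ x′) ⊑ ρ

record CoherentPlay {P x} (f : Strategy P x) (f′ : Strategy (opposing P) x) (ρ : Seq) : Set₁ where
  field
    isPlay    : IsPlay (starter P) x ρ
    coherent  : Coherent f ρ
    coherent′ : Coherent f′ ρ

ProperlyExtends : Seq → Seq → Set₁
ProperlyExtends ρ (fin π) = π ⊏ ρ
ProperlyExtends ρ (inf σ) = Level.Lift _ ⊥

-- ρ is the play f * f′.

record IsProduct {P x} (f : Strategy P x) (f′ : Strategy (opposing P) x) (ρ : Seq) : Set₁ where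
  field
    coherentPlay : CoherentPlay f f′ ρ
    maximal      : ∀ ρ′ → CoherentPlay f f′ ρ′ → ¬ ProperlyExtends ρ′ ρ

NonLosing : ∀ {P x} → Strategy P x → Set₁
NonLosing {P} {x} f = ∀ (f′ : Strategy (opposing P) x) ρ → IsProduct f f′ ρ →
                      NonLosingPlay (side P) (starter P) x ρ

HasNonLosingRole : Role → Hypergame → Set₁
HasNonLosingRole P x = Σ[ f ∈ Strategy P x ] NonLosing f

data Player : Set where
  L R I II : Player

HasNonLosing : Player → Hypergame → Set₁
HasNonLosing L  x = HasNonLosingRole LI  x × HasNonLosingRole LII x
HasNonLosing R  x = HasNonLosingRole RI  x × HasNonLosingRole RII x
HasNonLosing I  x = HasNonLosingRole LI  x × HasNonLosingRole RI  x
HasNonLosing II x = HasNonLosingRole LII x × HasNonLosingRole RII x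

------------------------------------------------------------------------
-- Equideterminacy and contextual equivalence

infix 4 _⇕_ _≈_

_⇕_ : Hypergame → Hypergame → Set₁
x ⇕ y = ∀ (P : Player) → HasNonLosing P x ⇔ HasNonLosing P y

data Context : Set₁ where
  hole : Context
  _+ᶜ_ : Context → Hypergame → Context
  _ᶜ+_ : Hypergame → Context → Context

plug : Context → Hypergame → Hypergame
plug hole     x = x
plug (C +ᶜ z) x = plug C x + z
plug (z ᶜ+ C) x = z + plug C x

_≈_ : Hypergame → Hypergame → Set₁
x ≈ y = ∀ (C : Context) → plug C x ⇕ plug C y

{-# OPTIONS --safe #-}
module Submission where

-- Draws make a player fail to win without losing, so the notion to follow is
-- that of a forced loss: Loses K s x says that K can be driven to a loss on x
-- when s starts.  A forced loss comes after finitely many moves, however K plays,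
-- hence Loses is an inductive predicate even on games with cycles.
-- It settles the existence of strategies: P has a non-losing strategy exactly
-- if P is not forced to lose (¬loses⇒nonLosing, nonLosing⇒¬loses).  A player
-- who is not forced to lose keeps moving to positions with that property;
-- conversely, a forced loss refutes any strategy by following it down the
-- derivation of Loses.
--
-- Every additive context applied to x equals x + z for some z that does not
-- depend on x (plug-+).  For the implication from left to right it is therefore
-- enough that Loses K s (x + z) implies Loses K s (y + z) when g x = g y
-- (Loses-≃).  This is the usual Sprague-Grundy argument, run along the
-- derivation of Loses so that z may be an arbitrary hypergame.  A move in z is
-- copied.  A move in one impartial component to a smaller Grundy value is copied
-- in the other one, and a move to a larger value is answered by a move back to
-- the old value.  Moving back does not shorten the derivation when it is made
-- in y, but it makes y smaller, so the induction is lexicographic.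
--
-- For the other implication, x + x is a loss for whoever starts, by copying
-- (copies-lose).  If g x and g y differ, then y + x is a loss for the second
-- player (Loses-≄): a single move of the starter reaches a position equivalent
-- to x + x or y + y.  So the context [ ] + x and the player II separate x from y.

open import Axiom.ExcludedMiddle using (ExcludedMiddle)
open import Axiom.Extensionality.Propositional using (Extensionality)
open import Data.Bool.Base using (Bool; T)
open import Data.Empty using (⊥)
open import Data.List.Base using (List; []; _∷_; _∷ʳ_; length)
open import Data.List.Properties using (length-++-sucʳ; ++-identityʳ)
open import Data.List.Relation.Binary.Pointwise as Listwise
  using (Pointwise; []; _∷_; Pointwise-length)
open import Data.List.Relation.Binary.Prefix.Heterogeneous using (Prefix; []; _∷_; _++ᵖ_)
open import Data.List.Relation.Binary.Prefix.Heterogeneous.Properties as Prefixₚ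
  using (fromPointwise)
open import Data.List.Reverse using (Reverse; []; _∶_∶ʳ_; reverseView)
open import Data.Maybe using (Maybe; just; nothing; Is-just)
open import Data.Maybe.Relation.Binary.Pointwise as Maybewise using ()
open import Data.Maybe.Relation.Unary.Any using (just)
open import Data.Nat.Base using (zero; suc; _<_; s≤s; z<s; s<s)
open import Data.Nat.Properties using (≤-reflexive; m≤n⇒m≤1+n)
open import Data.Product.Base using (∃-syntax; Σ-syntax; _×_; _,_; proj₁; proj₂; map)
open import Data.Sum.Base using (_⊎_; inj₁; inj₂; [_,_]′)
open import Data.Unit.Base using (⊤; tt)
open import Function.Base using (_∘_; const)
open import Function.Bundles using (_⇔_; mk⇔; Equivalence)
open import Level using (Lift; lift; lower; 0ℓ)
open import Relation.Binary.PropositionalEquality.Core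
  using (_≡_; _≢_; refl; sym; trans; cong; subst; subst₂)
open import Relation.Nullary.Decidable
  using (yes; no; isYes; isYes≗does; does-⇔; toWitness; fromWitness)
open import Relation.Nullary.Negation using (¬_; contradiction)
open import Defs

open Coalgebra
open Hypergame
open IsBisimulation
open Role
open FPlay
open Strategy
open CoherentPlay
open IsProduct
open Ord
open IsMex

private
  variable
    K s : Side
    u v w x y z x′ y′ : Hypergame
    π π′ ρ : List Hypergame
    P : Role

------------------------------------------------------------------------
-- Sides

opponent-involutive : ∀ s → opponent (opponent s) ≡ s
opponent-involutive L = refl
opponent-involutive R = refl

s≢opponent : s ≢ opponent s
s≢opponent {L} ()
s≢opponent {R} ()

same-or-opponent : ∀ s K → s ≡ K ⊎ s ≡ opponent K
same-or-opponent L L = inj₁ refl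
same-or-opponent L R = inj₂ refl
same-or-opponent R L = inj₂ refl
same-or-opponent R R = inj₁ refl

turn-opponent : ∀ s n → turn (opponent s) n ≡ opponent (turn s n)
turn-opponent s zero    = refl
turn-opponent s (suc n) = cong opponent (turn-opponent s n)

------------------------------------------------------------------------
-- Equality of hypergames

≅-option : x ≅ y → ∀ K (i : Option K x) → ∃[ j ] (option K x i ≅ option K y j)
≅-option (_∼_ , bis , r) K i with forth bis r K i
... | j , r′ = j , _∼_ , bis , r′

∈-resp : x ≅ x′ → y ≅ y′ → y ∈[ K ] x → y′ ∈[ K ] x′
∈-resp {K = K} x≅x′ y≅y′ (i , e) with ≅-option x≅x′ K i
... | j , e′ = j , ≅-trans (≅-sym e′) (≅-trans e y≅y′)

------------------------------------------------------------------------
-- Plays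

end-∷ʳ : ∀ x π y → end x (π ∷ʳ y) ≡ y
end-∷ʳ x []      y = refl
end-∷ʳ x (a ∷ π) y = end-∷ʳ a π y

length-∷ʳ : ∀ (π : List Hypergame) y → length (π ∷ʳ y) ≡ suc (length π)
length-∷ʳ π y = trans (length-++-sucʳ π y []) (cong (suc ∘ length) (++-identityʳ π))

end-resp : x ≅ x′ → Pointwise _≅_ π π′ → end x π ≅ end x′ π′
end-resp e []       = e
end-resp e (e′ ∷ p) = end-resp e′ p

play-resp : x ≅ x′ → Pointwise _≅_ π π′ → IsFinPlay s x π → IsFinPlay s x′ π′
play-resp e []       []      = []
play-resp e (e′ ∷ p) (m ∷ q) = ∈-resp e e′ m ∷ play-resp e′ p q

play-∷ʳ⁺ : IsFinPlay s x π → y ∈[ turn s (length π) ] end x π → IsFinPlay s x (π ∷ʳ y)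
play-∷ʳ⁺ []              m  = m ∷ []
play-∷ʳ⁺ {s = s} {π = _ ∷ π} (m ∷ p) m′ =
  m ∷ play-∷ʳ⁺ p (subst (λ t → _ ∈[ t ] _) (sym (turn-opponent s (length π))) m′)

play-∷ʳ⁻ : ∀ π → IsFinPlay s x (π ∷ʳ y) →
           IsFinPlay s x π × y ∈[ turn s (length π) ] end x π
play-∷ʳ⁻ []      (m ∷ []) = [] , m
play-∷ʳ⁻ {s = s} (_ ∷ π) (m ∷ p) with play-∷ʳ⁻ π p
... | q , m′ = m ∷ q , subst (λ t → _ ∈[ t ] _) (turn-opponent s (length π)) m′

prefix-play : x ≅ x′ → Prefix _≅_ π ρ → IsFinPlay s x′ ρ → IsFinPlay s x π
prefix-play e []       _       = []
prefix-play e (e′ ∷ p) (m ∷ q) = ∈-resp (≅-sym e) (≅-sym e′) m ∷ prefix-play e′ p q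

pointwise-∷ʳ : Pointwise _≅_ π π′ → y ≅ y′ → Pointwise _≅_ (π ∷ʳ y) (π′ ∷ʳ y′)
pointwise-∷ʳ p e = Listwise.++⁺ p (e ∷ [])

pointwise-refl : Pointwise _≅_ π π
pointwise-refl = Listwise.refl ≅-refl

prefix-resp : Pointwise _≅_ π π′ → Prefix _≅_ π ρ → Prefix _≅_ π′ ρ
prefix-resp p q = Prefixₚ.trans ≅-trans (fromPointwise (Listwise.symmetric ≅-sym p)) q

⊏-∷ʳ : π ⊏ fin ρ → π ⊏ fin (ρ ∷ʳ y)
⊏-∷ʳ {ρ = ρ} {y = y} (p , l) =
  p ++ᵖ _ , subst (_ <_) (sym (length-∷ʳ ρ y)) (m≤n⇒m≤1+n l)

⊏-self : π ⊏ fin (π ∷ʳ y)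
⊏-self {π} {y} = fromPointwise pointwise-refl ++ᵖ _ , ≤-reflexive (sym (length-∷ʳ π y))

-- Proper prefixes of ρ ∷ʳ y end before ρ does or at the end of ρ; this reduces
-- coherence of a play extended by one move to the reply at its last position.
⊏-∷ʳ-split : ∀ ρ → π ⊏ fin (ρ ∷ʳ y) → π ⊏ fin ρ ⊎ Pointwise _≅_ π ρ
⊏-∷ʳ-split []      ([] , _)             = inj₂ []
⊏-∷ʳ-split []      (_ ∷ _ , s≤s ())
⊏-∷ʳ-split (_ ∷ ρ) ([] , _)             = inj₁ ([] , z<s)
⊏-∷ʳ-split (_ ∷ ρ) (e ∷ p , s≤s l) with ⊏-∷ʳ-split ρ (p , l)
... | inj₁ (q , l′) = inj₁ (e ∷ q , s<s l′)
... | inj₂ q        = inj₂ (e ∷ q)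

⊏-next : π ⊏ fin ρ → ∃[ y ] ((π ∷ʳ y) ⊑ fin ρ)
⊏-next {ρ = y ∷ ρ} ([] , _)          = y , ≅-refl ∷ []
⊏-next             (e ∷ p , s≤s l)   with ⊏-next (p , l)
... | y , q = y , e ∷ q

-- This makes a coherent play maximal when the player to move at its end has no
-- options.  The starting positions x and x′ are kept apart for the induction,
-- since after a first move the positions of π and ρ agree only up to ≅.
continues : ∀ π ρ → x ≅ x′ → IsPlay s x′ ρ → π ⊏ ρ →
            ∃[ y ] (y ∈[ turn s (length π) ] end x π)
continues []      (fin (y ∷ ρ)) e (m ∷ _)  _       = y , ∈-resp (≅-sym e) ≅-refl m
continues []      (inf σ)       e (m , _)  _       = σ 0 , ∈-resp (≅-sym e) ≅-refl m
continues {s = s} (_ ∷ π) (fin (_ ∷ ρ)) e (_ ∷ p)  (e′ ∷ q , s≤s l)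
  with continues π (fin ρ) e′ p (q , l)
... | y , m = y , subst (λ t → y ∈[ t ] _) (turn-opponent s (length π)) m
continues {s = s} (_ ∷ π) (inf σ)       e (_ , ms) (e′ ∷ q)
  with continues π (inf (σ ∘ suc)) e′
         (ms 0 , λ n → subst (λ t → σ (suc (suc n)) ∈[ opponent t ] σ (suc n))
                             (sym (turn-opponent s n)) (ms (suc n))) q
... | y , m = y , subst (λ t → y ∈[ t ] _) (turn-opponent s (length π)) m

------------------------------------------------------------------------
-- Forced losses

-- The equations on s, rather than an index, let s be the term turn s₀ n.
data Loses (K s : Side) (x : Hypergame) : Set where
  own   : s ≡ K → (∀ i → Loses K (opponent s) (option s x i)) → Loses K s x
  other : s ≡ opponent K → ∀ i → Loses K (opponent s) (option s x i) → Loses K s x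

Loses-resp : x ≅ y → Loses K s x → Loses K s y
Loses-resp {s = s} x≅y (own e k) = own e λ j →
  let i , e′ = ≅-option (≅-sym x≅y) s j in Loses-resp (≅-sym e′) (k i)
Loses-resp {s = s} x≅y (other e i l) =
  let j , e′ = ≅-option x≅y s i in other e j (Loses-resp e′ l)

-- Each derivation prescribes the moves of one player and covers all moves of the
-- other, so together they determine a play.  That play never stops, although
-- every move shortens the derivations.
Loses-exclusive : Loses K s x → ¬ Loses (opponent K) s x
Loses-exclusive (own refl _)    (own e _)      = s≢opponent e
Loses-exclusive (own _ k)       (other _ i l)  = Loses-exclusive (k i) l
Loses-exclusive (other _ i l)   (own _ k)      = Loses-exclusive l (k i)
Loses-exclusive (other refl _ _) (other e _ _) = s≢opponent e

------------------------------------------------------------------------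
-- Coherent plays and their extensions

Option-∈ : ∀ x (i : Option K x) → option K x i ∈[ K ] x
Option-∈ x i = i , ≅-refl

fplay : ∀ {P x} π → IsFinPlay (starter P) x π → turn (starter P) (length π) ≡ side P → FPlay P x
fplay π p t = record { moves = π ; isPlay = p ; toMove = t }

coherent-∷ʳ : (f : Strategy P x) → Coherent f (fin π) →
              (∀ π′ → Pointwise _≅_ (moves π′) π → ∀ {x′} → reply f π′ ≡ just x′ → x′ ≅ y) →
              Coherent f (fin (π ∷ʳ y))
coherent-∷ʳ {π = π} f c h π′ p r with ⊏-∷ʳ-split π p
... | inj₁ q = c π′ q r ++ᵖ _
... | inj₂ q = fromPointwise (pointwise-∷ʳ q (h π′ q r))

reply-agree : (f : Strategy P x) (π π′ : FPlay P x) → Pointwise _≅_ (moves π) (moves π′) →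
              reply f π ≡ just y → reply f π′ ≡ just y′ → y ≅ y′
reply-agree f π π′ p r r′ with reply f π | reply f π′ | resp f π π′ p | r | r′
... | _ | _ | Maybewise.just e | refl | refl = e

coherent-reply : (f : Strategy P x) (π : FPlay P x) → Coherent f (fin (moves π)) →
                 reply f π ≡ just y → Coherent f (fin (moves π ∷ʳ y))
coherent-reply f π c r = coherent-∷ʳ f c λ π′ p r′ → reply-agree f π′ π p r′ r

coherent-wait : (f : Strategy P x) → turn (starter P) (length π) ≡ opponent (side P) →
                Coherent f (fin π) → Coherent f (fin (π ∷ʳ y))
coherent-wait {P = P} f t c = coherent-∷ʳ f c λ π′ p _ →
  contradiction (trans (sym (toMove π′))
                       (trans (cong (turn (starter P)) (Pointwise-length p)) t)) s≢opponent

coherent-init : (f : Strategy P x) → ∀ π → Coherent f (fin (π ∷ʳ y)) → Coherent f (fin π)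
coherent-init f π c π′ p@(_ , l) r with c π′ (⊏-∷ʳ p) r
... | q = shorten (moves π′) π q l
  where
  shorten : ∀ π′ π {x y} → Prefix _≅_ (π′ ∷ʳ x) (π ∷ʳ y) → length π′ < length π →
            Prefix _≅_ (π′ ∷ʳ x) π
  shorten []       (_ ∷ _) (e ∷ _) _       = e ∷ []
  shorten (_ ∷ π′) (_ ∷ π) (e ∷ q) (s≤s l) = e ∷ shorten π′ π q l

replies : (f : Strategy P x) (π : FPlay P x) →
          Option (turn (starter P) (length (moves π))) (end x (moves π)) →
          ∃[ y ] (reply f π ≡ just y)
replies {x = x} f π i
  with reply f π | total f π (play-∷ʳ⁺ (isPlay π) (Option-∈ (end x (moves π)) i))
... | just y | just _ = y , refl

-- The product is a maximal coherent play, and at a position with options the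
-- strategy of the player to move provides a longer one.
product-stuck : (f : Strategy P x) (f′ : Strategy (opposing P) x) → IsProduct f f′ (fin π) →
                ¬ Option (turn (starter P) (length π)) (end x π)
product-stuck {P = P} {π = π} f f′ prod i
  with coherentPlay prod | same-or-opponent (turn (starter P) (length π)) (side P)
... | cp | inj₁ t =
  let π₀ = fplay π (isPlay cp) t
      y , r = replies f π₀ i
  in maximal prod (fin (π ∷ʳ y))
       record { isPlay    = legal f π₀ r
              ; coherent  = coherent-reply f π₀ (coherent cp) r
              ; coherent′ = coherent-wait f′ (trans t (sym (opponent-involutive (side P))))
                                          (coherent′ cp) }
       ⊏-self
... | cp | inj₂ t =
  let π₀ = fplay π (isPlay cp) t
      y , r = replies f′ π₀ i
  in maximal prod (fin (π ∷ʳ y))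
       record { isPlay    = legal f′ π₀ r
              ; coherent  = coherent-wait f t (coherent cp)
              ; coherent′ = coherent-reply f′ π₀ (coherent′ cp) r }
       ⊏-self

------------------------------------------------------------------------
-- Forced losses decide the existence of non-losing strategies

module _ (em : ∀ {ℓ} → ExcludedMiddle ℓ) (ext : ∀ {a b} → Extensionality a b) where

  -- A choice function on classes of hypergames whose value depends only on the
  -- extension of the class: strategies must reply equally to equal plays, but
  -- equivalent predicates need not be equal as functions into Set₁.  Boolean
  -- characteristic functions of equivalent predicates are equal, so choosing
  -- from these is well defined.
  holds : Set₁ → Bool
  holds A = isYes (em {P = A})

  witness : (Hypergame → Bool) → Maybe Hypergame
  witness χ with em {P = ∃[ y ] T (χ y)}
  ... | yes (y , _) = just y
  ... | no _        = nothing

  choose : (Hypergame → Set₁) → Maybe Hypergame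
  choose A = witness (holds ∘ A)

  choose-cong : ∀ {A B : Hypergame → Set₁} → (∀ y → A y ⇔ B y) → choose A ≡ choose B
  choose-cong A⇔B = cong witness (ext λ y →
    trans (isYes≗does em) (trans (does-⇔ (A⇔B y) em em) (sym (isYes≗does em))))

  choose-sound : ∀ {A : Hypergame → Set₁} → choose A ≡ just y → A y
  choose-sound {A = A} r with em {P = ∃[ y ] T (holds (A y))}
  choose-sound refl | yes (_ , t) = toWitness t

  choose-complete : ∀ {A : Hypergame → Set₁} → A y → Is-just (choose A)
  choose-complete {A = A} a with em {P = ∃[ y ] T (holds (A y))}
  ... | yes _ = just tt
  ... | no ¬p = contradiction (_ , fromWitness a) ¬p

  Legal : Side → Hypergame → List Hypergame → Hypergame → Set₁
  Legal s x π y = IsFinPlay s x (π ∷ʳ y)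

  -- Strategies are built from advice: the strategy follows A whenever some legal
  -- move does, and is legal in any case.  Advice that respects ≅ on plays
  -- suffices, because choose is extensional.
  advised : ∀ {P x} (A : List Hypergame → Hypergame → Set₁) →
            (∀ {π π′ y} → Pointwise _≅_ π π′ → A π y → A π′ y) →
            Σ[ f ∈ Strategy P x ] ∀ π {y} → reply f π ≡ just y →
              ∃[ y′ ] (Legal (starter P) x (moves π) y′ × A (moves π) y′) → A (moves π) y
  advised {P} {x} A A-resp = f , λ π r → proj₂ (choose-sound r)
    where
    Good : List Hypergame → Hypergame → Set₁
    Good π y = Legal (starter P) x π y × (∃[ y′ ] (Legal (starter P) x π y′ × A π y′) → A π y)

    legal-resp : Pointwise _≅_ π π′ → Legal (starter P) x π y → Legal (starter P) x π′ y
    legal-resp p = play-resp ≅-refl (pointwise-∷ʳ p ≅-refl)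

    good-resp : Pointwise _≅_ π π′ → Good π y → Good π′ y
    good-resp p (l , a) = legal-resp p l , λ { (y′ , l′ , a′) →
      let p⁻ = Listwise.symmetric ≅-sym p in
      A-resp p (a (y′ , legal-resp p⁻ l′ , A-resp p⁻ a′)) }

    f : Strategy P x
    f .reply π   = choose (Good (moves π))
    f .legal π r = proj₁ (choose-sound r)
    f .total π {x′} l
      with em {P = ∃[ y′ ] (Legal (starter P) x (moves π) y′ × A (moves π) y′)}
    ... | yes (y , l′ , a) = choose-complete {y = y} (l′ , const a)
    ... | no ¬a            = choose-complete {y = x′} (l , λ a → contradiction a ¬a)
    f .resp π π′ p = Maybewise.reflexive (λ { refl → ≅-refl })
      (choose-cong λ y → mk⇔ (good-resp p) (good-resp (Listwise.symmetric ≅-sym p)))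

  -- A strategy taking part in a given finite play, used to realise that play as
  -- a product.
  follow : ∀ {P x ρ} → IsFinPlay (starter P) x ρ → Σ[ f ∈ Strategy P x ] Coherent f (fin ρ)
  follow {ρ = ρ} q =
    let f , advice = advised (λ π y → (π ∷ʳ y) ⊑ fin ρ)
                             (λ p → prefix-resp (pointwise-∷ʳ p ≅-refl))
    in f , λ π p r → let y , p′ = ⊏-next p in
                     advice π r (y , prefix-play ≅-refl p′ q , p′)

  safe-option : s ≡ K → ¬ Loses K s x → ∃[ i ] (¬ Loses K (opponent s) (option s x i))
  safe-option {s} {K} {x} e ¬l with em {P = ∃[ i ] (¬ Loses K (opponent s) (option s x i))}
  ... | yes p = p
  ... | no ¬p = contradiction (own e all) ¬l
    where
    all : ∀ i → Loses K (opponent s) (option s x i)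
    all i with em {P = Loses K (opponent s) (option s x i)}
    ... | yes l = l
    ... | no ¬l′ = contradiction (i , ¬l′) ¬p

  -- The strategy moves to positions where no loss is forced.  This invariant
  -- holds along every coherent play, and at the end of a finite product, where
  -- the player to move is stuck, it excludes that this player is P.
  ¬loses⇒nonLosing : ¬ Loses (side P) (starter P) x → HasNonLosingRole P x
  ¬loses⇒nonLosing {P} {x} ¬l = f , nonLosing
    where
    K₀ s₀ : Side
    K₀ = side P
    s₀ = starter P

    Safe : List Hypergame → Hypergame → Set₁
    Safe π y = Lift _ (¬ Loses K₀ (turn s₀ (suc (length π))) y)

    survival : Σ[ f ∈ Strategy P x ] ∀ π {y} → reply f π ≡ just y →
               ∃[ y′ ] (Legal s₀ x (moves π) y′ × Safe (moves π) y′) → Safe (moves π) y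
    survival = advised Safe λ p → subst (λ n → Lift _ (¬ Loses K₀ (turn s₀ (suc n)) _))
                                        (Pointwise-length p)

    f : Strategy P x
    f = proj₁ survival

    safe-reply : ∀ π {y} → reply f π ≡ just y →
                 ¬ Loses K₀ (turn s₀ (length (moves π))) (end x (moves π)) → Safe (moves π) y
    safe-reply π r ¬l =
      let i , ¬l′ = safe-option (toMove π) ¬l
      in proj₂ survival π r (_ , play-∷ʳ⁺ (isPlay π) (Option-∈ _ i) , lift ¬l′)

    last : ∀ π {y y′} → Prefix _≅_ (π ∷ʳ y) (π ∷ʳ y′) → y ≅ y′
    last []      (e ∷ _) = e
    last (_ ∷ π) (_ ∷ p) = last π p

    after-∷ʳ : ∀ π {y} → Loses K₀ (turn s₀ (length (π ∷ʳ y))) (end x (π ∷ʳ y)) →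
               Loses K₀ (turn s₀ (suc (length π))) y
    after-∷ʳ π {y} = subst₂ (λ n → Loses K₀ (turn s₀ n)) (length-∷ʳ π y) (end-∷ʳ x π y)

    safe : Reverse π → IsFinPlay s₀ x π → Coherent f (fin π) →
           ¬ Loses K₀ (turn s₀ (length π)) (end x π)
    safe []            p c = ¬l
    safe (π ∶ rs ∶ʳ y) p c l with play-∷ʳ⁻ π p
    ... | q , i , e with safe rs q (coherent-init f π c) | same-or-opponent (turn s₀ (length π)) K₀
    ... | ¬l′ | inj₂ t = ¬l′ (other t i (Loses-resp (≅-sym e) (after-∷ʳ π l)))
    ... | ¬l′ | inj₁ t with replies f (fplay π q t) i
    ... | y′ , r = lower (safe-reply (fplay π q t) r ¬l′)
                     (Loses-resp (≅-sym (last π (c (fplay π q t) ⊏-self r))) (after-∷ʳ π l))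

    nonLosing : NonLosing f
    nonLosing f′ (inf σ) prod = draw
    nonLosing f′ (fin π) prod with same-or-opponent (turn s₀ (length π)) K₀
    ... | inj₂ t = win (t , subst (λ t → ¬ Option t (end x π)) t (product-stuck f f′ prod))
    ... | inj₁ t with safe-option t (safe (reverseView π) (isPlay (coherentPlay prod))
                                                          (coherent (coherentPlay prod)))
    ... | i , _ = contradiction i (product-stuck f f′ prod)

  -- Along the derivation of the forced loss, a play coherent with f grows: f
  -- moves for P and the derivation moves for the opponent.  When f has no reply,
  -- the play built so far is the product of f with an opponent following that
  -- play, and it is lost for P.
  nonLosing⇒¬loses : HasNonLosingRole P x → ¬ Loses (side P) (starter P) x
  nonLosing⇒¬loses {P} {x} (f , nl) l = refute [] refl [] (λ { _ (_ , ()) _ }) ≅-refl l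
    where
    refute : ∀ π → s ≡ turn (starter P) (length π) → IsFinPlay (starter P) x π →
             Coherent f (fin π) → w ≅ end x π → Loses (side P) s w → ⊥

    refute-∷ʳ : ∀ π → s ≡ turn (starter P) (length π) → IsFinPlay (starter P) x (π ∷ʳ y) →
                Coherent f (fin (π ∷ʳ y)) → w ≅ y → Loses (side P) (opponent s) w → ⊥
    refute-∷ʳ {y = y} π refl p c e l = refute (π ∷ʳ y)
      (sym (cong (turn (starter P)) (length-∷ʳ π y))) p c (subst (_ ≅_) (sym (end-∷ʳ x π y)) e) l

    refute π refl p c e (other t i l) = refute-∷ʳ π refl
      (play-∷ʳ⁺ p (∈-resp e ≅-refl (Option-∈ _ i))) (coherent-wait f t c) ≅-refl l
    -- The derivation covers every option, in particular the reply of f.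
    refute π refl p c e (own t k) with reply f (fplay π p t) in r
    ... | just y =
      let i , e′ = ∈-resp (≅-sym e) ≅-refl (proj₂ (play-∷ʳ⁻ π (legal f (fplay π p t) r)))
      in refute-∷ʳ π refl (legal f (fplay π p t) r) (coherent-reply f (fplay π p t) c r) e′ (k i)
    ... | nothing = s≢opponent (trans (sym t) (lost (nl f′ (fin π) record
            { coherentPlay = record { isPlay = p ; coherent = c ; coherent′ = c′ }
            ; maximal      = λ ρ cp q →
                let y , m = continues π ρ ≅-refl (isPlay cp) q
                in unanswered (total f (fplay π p t) (play-∷ʳ⁺ p m)) })))
      where
      f′ : Strategy (opposing P) x
      f′ = proj₁ (follow p)
      c′ : Coherent f′ (fin π)
      c′ = proj₂ (follow p)
      lost : NonLosingPlay (side P) (starter P) x (fin π) →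
             turn (starter P) (length π) ≡ opponent (side P)
      lost (win (t , _)) = t
      unanswered : ¬ Is-just (reply f (fplay π p t))
      unanswered j with () ← subst Is-just r j

------------------------------------------------------------------------
-- Sums and contexts

+-cong : x ≅ x′ → y ≅ y′ → x + y ≅ x′ + y′
+-cong (_∼_ , bis , r) (_∼′_ , bis′ , r′) =
  (λ (a , b) (a′ , b′) → a ∼ a′ × b ∼′ b′) ,
  record
    { forth = λ { (p , q) K (inj₁ i) → let j , p′ = forth bis p K i in inj₁ j , p′ , q
                ; (p , q) K (inj₂ i) → let j , q′ = forth bis′ q K i in inj₂ j , p , q′ }
    ; back  = λ { (p , q) K (inj₁ j) → let i , p′ = back bis p K j in inj₁ i , p′ , q
                ; (p , q) K (inj₂ j) → let i , q′ = back bis′ q K j in inj₂ i , p , q′ } } ,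
  r , r′

+-comm : ∀ x y → x + y ≅ y + x
+-comm x y =
  (λ (a , b) (b′ , a′) → a ≡ a′ × b ≡ b′) ,
  record
    { forth = λ { (refl , refl) K (inj₁ i) → inj₂ i , refl , refl
                ; (refl , refl) K (inj₂ j) → inj₁ j , refl , refl }
    ; back  = λ { (refl , refl) K (inj₁ j) → inj₂ j , refl , refl
                ; (refl , refl) K (inj₂ i) → inj₁ i , refl , refl } } ,
  refl , refl

+-assoc : ∀ x y z → (x + y) + z ≅ x + (y + z)
+-assoc x y z =
  (λ ((a , b) , c) d → (a , b , c) ≡ d) ,
  record
    { forth = λ { refl K (inj₁ (inj₁ i)) → inj₁ i , refl
                ; refl K (inj₁ (inj₂ j)) → inj₂ (inj₁ j) , refl
                ; refl K (inj₂ k)        → inj₂ (inj₂ k) , refl }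
    ; back  = λ { refl K (inj₁ i)        → inj₁ (inj₁ i) , refl
                ; refl K (inj₂ (inj₁ j)) → inj₁ (inj₂ j) , refl
                ; refl K (inj₂ (inj₂ k)) → inj₂ k , refl } } ,
  refl

𝟘 : Hypergame
𝟘 = pointed record { Carrier = ⊤ ; Move = λ _ _ → ⊥ ; next = λ _ _ () } tt

+-identityʳ : ∀ x → x + 𝟘 ≅ x
+-identityʳ x =
  (λ (a , _) a′ → a ≡ a′) ,
  record
    { forth = λ { refl K (inj₁ i) → i , refl ; refl K (inj₂ ()) }
    ; back  = λ { refl K i → inj₁ i , refl } } ,
  refl

-- Commutativity and associativity collect the summands of a context.
plug-+ : ∀ C → ∃[ z ] (∀ x → plug C x ≅ x + z)
plug-+ hole = 𝟘 , λ x → ≅-sym (+-identityʳ x)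
plug-+ (C +ᶜ z′) with plug-+ C
... | z , e = z + z′ , λ x → ≅-trans (+-cong (e x) ≅-refl) (+-assoc x z z′)
plug-+ (z′ ᶜ+ C) with plug-+ C
... | z , e = z + z′ , λ x →
  ≅-trans (+-comm z′ (plug C x)) (≅-trans (+-cong (e x) ≅-refl) (+-assoc x z z′))

------------------------------------------------------------------------
-- Impartial games among hypergames

-- Impartial games enter through hypergames u ≅ ⌜ x ⌝ rather than through ⌜ x ⌝
-- itself: options of ⌜ x ⌝ are games of this form only up to ≅, and option K
-- (u + z) then computes to a sum of the same shape.
module _ {A : Set} {f : A → Impartial} where

  represents : u ≅ ⌜ sup A f ⌝ → (i : Option K u) → ∃[ a ] (option K u i ≅ ⌜ f a ⌝)
  represents {K = K} p i =
    let a , e = ≅-option p K i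
    in a , ≅-trans e (proj₂ (proj₁ (unfold-isHom impartials (sup A f) K) a))

  represented : u ≅ ⌜ sup A f ⌝ → ∀ K a → ∃[ i ] (option K u i ≅ ⌜ f a ⌝)
  represented p K a =
    let i , e = ≅-option (≅-sym p) K a
    in i , ≅-trans (≅-sym e) (proj₂ (proj₁ (unfold-isHom impartials (sup A f) K) a))

-- The second player copies every move of the first in the other component,
-- which leaves two copies of an option of x.
copies-lose : ∀ x → u ≅ ⌜ x ⌝ → v ≅ ⌜ x ⌝ → s ≡ K → Loses K s (u + v)

copies-lose-option : ∀ x → u ≅ ⌜ x ⌝ → v ≅ ⌜ x ⌝ → s ≡ K →
                     ∀ i → Loses K (opponent s) (option s (u + v) i)

copies-lose x p q t = own t (copies-lose-option x p q t)

copies-lose-option {s = s} {K = K} (sup A f) p q t (inj₁ i) =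
  let a , p′ = represents p i
      j , q′ = represented q (opponent s) a
  in other (cong opponent t) (inj₂ j)
       (copies-lose (f a) p′ q′ (trans (opponent-involutive s) t))
copies-lose-option {s = s} {K = K} (sup A f) p q t (inj₂ j) =
  let a , q′ = represents q j
      i , p′ = represented p (opponent s) a
  in other (cong opponent t) (inj₁ i)
       (copies-lose (f a) p′ q′ (trans (opponent-involutive s) t))

------------------------------------------------------------------------
-- The Grundy function

≈ₒ-sym : ∀ α β → α ≈ₒ β → β ≈ₒ α
≈ₒ-sym α β = ≐-sym (set α) (set β)

≈ₒ-trans : ∀ α β γ → α ≈ₒ β → β ≈ₒ γ → α ≈ₒ γ
≈ₒ-trans α β γ = ≐-trans (set α) (set β) (set γ)

module _ (em : ExcludedMiddle 0ℓ) where

  -- If β were missing from S, then minimality would give μ ≤ β.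
  mex-below : ∀ {A : Set} {S : A → Ord} {μ} → IsMex S μ → ∀ β → β <ₒ μ → β ∈ₒ S
  mex-below {S = S} {μ} m β β<μ with em {P = β ∈ₒ S}
  ... | yes β∈S = β∈S
  ... | no β∉S with least m β β∉S
  ... | inj₁ μ<β = contradiction (transitive μ μ<β β<μ) (∈-irrefl (set μ))
  ... | inj₂ μ≈β = contradiction (∈-respˡ (set μ) (≈ₒ-sym μ β μ≈β) β<μ) (∈-irrefl (set μ))

  module GrundyFunction (g : Impartial → Ord)
                        (g-mex : ∀ {A} (f : A → Impartial) → IsMex (g ∘ f) (g (sup A f))) where

    infix 4 _≃_

    _≃_ : Impartial → Impartial → Set
    x ≃ y = g x ≈ₒ g y

    ≃-sym : ∀ x y → x ≃ y → y ≃ x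
    ≃-sym x y = ≈ₒ-sym (g x) (g y)

    ≃-trans : ∀ x y z → x ≃ y → y ≃ z → x ≃ z
    ≃-trans x y z = ≈ₒ-trans (g x) (g y) (g z)

    module _ {A : Set} (f : A → Impartial) where

      option-≄ : ∀ a → ¬ (f a ≃ sup A f)
      option-≄ a e = excluded (g-mex f) (a , e)

      option-below : ∀ y → g y <ₒ g (sup A f) → ∃[ a ] (f a ≃ y)
      option-below y = mex-below (g-mex f) (g y)

    -- The five lemmas are proved together by lexicographic induction on the
    -- derivation of Loses and on y.  Steps through descend shorten the
    -- derivation; steps through ascend keep it and replace y by an option.
    Loses-≃ : ∀ x y → u ≅ ⌜ x ⌝ → v ≅ ⌜ y ⌝ → x ≃ y → Loses K s (u + z) → Loses K s (v + z)

    -- Whichever Grundy value is larger, the component with that value has an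
    -- option of the smaller one: K is to move at u + z and may be assumed to
    -- move there (descend), or the opponent moves there from v + z (ascend).
    Loses-≄ : ∀ x y → u ≅ ⌜ x ⌝ → v ≅ ⌜ y ⌝ → ¬ (x ≃ y) → s ≡ K →
              Loses K s (u + z) → Loses K (opponent s) (v + z)

    -- The step of Loses-≃ where K moves.  It takes the derivation itself, not
    -- the family of its subderivations, so that passing it on to Loses-≄ is
    -- visibly no increase.
    own-≃ : ∀ x y → u ≅ ⌜ x ⌝ → v ≅ ⌜ y ⌝ → x ≃ y → s ≡ K → Loses K s (u + z) →
            ∀ i → Loses K (opponent s) (option s (v + z) i)

    descend : ∀ x y → u ≅ ⌜ x ⌝ → v ≅ ⌜ y ⌝ → s ≡ K → Loses K s (u + z) →
              g y <ₒ g x → Loses K (opponent s) (v + z)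

    ascend : ∀ x y → u ≅ ⌜ x ⌝ → v ≅ ⌜ y ⌝ → s ≡ K → Loses K s (u + z) →
             g x <ₒ g y → Loses K (opponent s) (v + z)

    Loses-≃ x y p q e (own t k) = own t (own-≃ x y p q e t (own t k))
    Loses-≃ x y p q e (other t (inj₂ i) l) = other t (inj₂ i) (Loses-≃ x y p q e l)
    Loses-≃ {K = K} {s = s} (sup A f) y p q e (other t (inj₁ i) l) =
      let a , p′ = represents p i in
      -- The opponent moved from x to another Grundy value, and it is K's turn.
      subst (λ s → Loses K s _) (opponent-involutive s)
        (Loses-≄ (f a) y p′ q
          (λ e′ → option-≄ f a (≃-trans (f a) y (sup A f) e′ (≃-sym (sup A f) y e)))
          (trans (cong opponent t) (opponent-involutive K)) l)

    own-≃ x y p q e refl (other t _ _) _ = contradiction t s≢opponent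
    own-≃ x y p q e t (own _ k) (inj₂ i) = Loses-≃ x y p q e (k (inj₂ i))
    own-≃ x (sup B h) p q e t (own t′ k) (inj₁ j) =
      let b , q′ = represents q j in
      Loses-≄ x (h b) p q′
        (λ e′ → option-≄ h b (≃-trans (h b) x (sup B h) (≃-sym x (h b) e′) e)) t (own t′ k)

    Loses-≄ x y p q ne t l =
      [ ascend x y p q t l , [ (λ e → contradiction e ne) , descend x y p q t l ]′ ]′
        (trichotomy em (g x) (g y))

    descend (sup A f) y p q refl (other t _ _) _ = contradiction t s≢opponent
    descend {s = s} (sup A f) y p q t (own _ k) y<x =
      let a , e  = option-below f y y<x
          i , p′ = represented p s a
      in Loses-≃ (f a) y p′ q e (k (inj₁ i))

    ascend {v = v} {s = s} {K = K} {z = z} x (sup B h) p q t l x<y =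
      let b , e  = option-below h x x<y
          j , q′ = represented q (opponent s) b
      in other (cong opponent t) (inj₁ j)
           (subst (λ s → Loses K s (option _ v j + z)) (sym (opponent-involutive s))
             (Loses-≃ x (h b) p q′ (≃-sym (h b) x e) l))

------------------------------------------------------------------------
-- Grundy values and contextual equivalence

HasNonLosing-map : (∀ P → HasNonLosingRole P x → HasNonLosingRole P y) →
                   ∀ P → HasNonLosing P x → HasNonLosing P y
HasNonLosing-map h L  = map (h LI)  (h LII)
HasNonLosing-map h R  = map (h RI)  (h RII)
HasNonLosing-map h I  = map (h LI)  (h RI)
HasNonLosing-map h II = map (h LII) (h RII)

theorem5p9 : (em : ∀ {ℓ} → ExcludedMiddle ℓ) → (ext : ∀ {a b} → Extensionality a b) →
    ∀ (x y : Impartial) → (grundy em x ≈ₒ grundy em y) ⇔ (⌜ x ⌝ ≈ ⌜ y ⌝)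
theorem5p9 em ext x y = mk⇔ (λ e C P → mk⇔ (preserves C x y e P)
                                           (preserves C y x (≃-sym x y e) P))
                            reflects
  where
  open GrundyFunction em (grundy em) (λ f → proj₂ (mex-exists em (grundy em ∘ f)))

  preserves : ∀ C x y → x ≃ y → ∀ P →
              HasNonLosing P (plug C ⌜ x ⌝) → HasNonLosing P (plug C ⌜ y ⌝)
  preserves C x y e = HasNonLosing-map λ P nl →
    let z , C≅ = plug-+ C
    in ¬loses⇒nonLosing em ext λ l → nonLosing⇒¬loses em ext nl
         (Loses-resp (≅-sym (C≅ ⌜ x ⌝))
           (Loses-≃ y x ≅-refl ≅-refl (≃-sym x y e) (Loses-resp (C≅ ⌜ y ⌝) l)))

  -- On x + x the starter is forced to lose, so the second player is not.
  copies-II : HasNonLosing II (⌜ x ⌝ + ⌜ x ⌝)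
  copies-II = second LII refl , second RII refl
    where
    second : ∀ P → starter P ≡ opponent (side P) → HasNonLosingRole P (⌜ x ⌝ + ⌜ x ⌝)
    second P t = ¬loses⇒nonLosing em ext λ l → Loses-exclusive l (copies-lose x ≅-refl ≅-refl t)

  reflects : ⌜ x ⌝ ≈ ⌜ y ⌝ → x ≃ y
  reflects x≈y with em {P = x ≃ y}
  ... | yes e = e
  ... | no ne = contradiction
    (Loses-≄ x y ≅-refl ≅-refl ne refl (copies-lose x ≅-refl ≅-refl refl))
    (nonLosing⇒¬loses em ext (proj₁ (Equivalence.to (x≈y (hole +ᶜ ⌜ x ⌝) II) copies-II)))
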